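{- Let $A$ be a distributive lattice, let $\mathbb{S} = (A, \prec)$ be any subordination algebra and let $\mathbb{A} = (A, \Rightarrow)$ be any slanted Heyting algebra. Then, for all $a,b,c \in A$: (i) $c\leq a\Rightarrow_{\prec} b$ if and only if $a\wedge c\prec b$; (ii) $\mathbb{S}_\ast = (A, \Rightarrow_{\prec})$ is a slanted Heyting algebra; (iii) $\mathbb{A}^\ast = (A, \prec_{\Rightarrow})$ is a subordination algebra; (iv) $a \prec_{\Rightarrow_{\prec}} b$ if and only if $a\prec b$, and $a \Rightarrow_{\prec_{\Rightarrow}} b = a\Rightarrow b$.
   Context: Lattices are bounded. For a lattice $A$, its canonical extension $A^\delta$ is the (unique up to isomorphism fixing $A$) complete lattice containing $A$ as a dense and compact sublattice. Here an element of $A^\delta$ is closed if it is $\bigwedge F$ for some nonempty $F\subseteq A$, and open if it is $\bigvee I$ for some nonempty $I\subseteq A$; $K(A^\delta)$ and $O(A^\delta)$ denote the sets of closed and open elements. Dense: every element of $A^\delta$ is both a join of closed elements and a meet of open elements. Compact: for all nonempty $F, I\subseteq A$, if $\bigwedge F\leq\bigvee I$ then $\bigwedge F'\leq \bigvee I'$ for some finite $F'\subseteq F$, $I'\subseteq I$. A subordination algebra is a pair $(A,\prec)$ where $A$ is a distributive lattice and ${\prec}\subseteq A\times A$ satisfies, for all $a,b,c,d\in A$: $\bot\prec\bot$ and $\top\prec\top$; if $a\prec b$ and $a\prec c$ then $a\prec b\wedge c$; if $a\prec c$ and $b\prec c$ then $a\vee b\prec c$; if $a\leq b\prec c\leq d$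 then $a\prec d$. A slanted Heyting algebra is a pair $(A,\Rightarrow)$ where $A$ is a distributive lattice and $\Rightarrow\,: A\times A\to A^\delta$ satisfies, for all $a,a_1,a_2,b,b_1,b_2,c\in A$: (1) $a\Rightarrow b\in O(A^\delta)$; (2) $a\Rightarrow(b_1\wedge b_2)=(a\Rightarrow b_1)\wedge(a\Rightarrow b_2)$ and $a\Rightarrow\top=\top$; (3) $(a_1\vee a_2)\Rightarrow b=(a_1\Rightarrow b)\wedge(a_2\Rightarrow b)$ and $\bot\Rightarrow b=\top$; (4) $c\leq a\Rightarrow b$ iff $a\wedge c\leq\top\Rightarrow b$. For a subordination algebra $(A,\prec)$, define $\Rightarrow_{\prec}\,: A\times A\to A^\delta$ by $a\Rightarrow_{\prec} b:=\bigvee\{c\in A\mid a\wedge c\prec b\}$ (join taken in $A^\delta$). For a slanted Heyting algebra $(A,\Rightarrow)$, define the relation $\prec_{\Rightarrow}$ on $A$ by: $a\prec_{\Rightarrow} b$ iff $a\leq\top\Rightarrow b$. The relation $\prec_{\Rightarrow_\prec}$ is obtained by applying the second construction to $\Rightarrow_{\prec}$, and $\Rightarrow_{\prec_\Rightarrow}$ by applying the first construction to $\prec_{\Rightarrow}$. -}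

module Defs where

open import Level using (Level; _⊔_; suc)
open import Algebra.Definitions using (_DistributesOverˡ_)
open import Data.List.Base using (List; foldr)
open import Data.List.Relation.Unary.All using (All)
open import Data.Product.Base using (∃; ∃₂; ∃-syntax; _×_)
open import Function.Bundles using (_⇔_)
open import Relation.Binary.Core using (Rel; _Preserves₂_⟶_⟶_)
open import Relation.Binary.Lattice.Bundles using (BoundedLattice)
open import Relation.Binary.Morphism.Structures using (IsOrderMonomorphism)
open import Relation.Unary using (Pred; Satisfiable; _∈_; _⊆_)

-- The library's DistributiveLattice has no bounds.
record BoundedDistributiveLattice (c ℓ₁ ℓ₂ : Level) : Set (suc (c ⊔ ℓ₁ ⊔ ℓ₂)) where
  field
    boundedLattice : BoundedLattice c ℓ₁ ℓ₂

  open BoundedLattice boundedLattice public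

  field
    ∧-distribˡ-∨ : _DistributesOverˡ_ _≈_ _∧_ _∨_

record CompleteLattice (c ℓ₁ ℓ₂ s : Level) : Set (suc (c ⊔ ℓ₁ ⊔ ℓ₂ ⊔ s)) where
  field
    boundedLattice : BoundedLattice c ℓ₁ ℓ₂

  open BoundedLattice boundedLattice public

  field
    ⋁ ⋀        : Pred Carrier s → Carrier
    ⋁-upper    : ∀ S {x} → x ∈ S → x ≤ ⋁ S
    ⋁-least    : ∀ S {u} → (∀ {x} → x ∈ S → x ≤ u) → ⋁ S ≤ u
    ⋀-lower    : ∀ S {x} → x ∈ S → ⋀ S ≤ x
    ⋀-greatest : ∀ S {u} → (∀ {x} → x ∈ S → u ≤ x) → u ≤ ⋀ S

module _ {c ℓ₁ ℓ₂ : Level} (A : BoundedLattice c ℓ₁ ℓ₂) where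
  private module A = BoundedLattice A

  -- A complete lattice containing A as a bounded sublattice, by way of the
  -- embedding e. Subsets of A are predicates at the level p of the order of
  -- the completion; their images under e then lie at level c ⊔ ℓ′ ⊔ p.
  record Completion (c′ ℓ′ p : Level) : Set (suc (c ⊔ ℓ₁ ⊔ ℓ₂ ⊔ c′ ⊔ ℓ′ ⊔ p)) where
    field
      completeLattice : CompleteLattice c′ ℓ′ p (c ⊔ ℓ′ ⊔ p)

    open CompleteLattice completeLattice public

    field
      e   : A.Carrier → Carrier
      e-isOrderMonomorphism : IsOrderMonomorphism A._≈_ _≈_ A._≤_ _≤_ e
      e-∧ : ∀ a b → e (a A.∧ b) ≈ e a ∧ e b
      e-∨ : ∀ a b → e (a A.∨ b) ≈ e a ∨ e b
      e-⊤ : e A.⊤ ≈ ⊤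
      e-⊥ : e A.⊥ ≈ ⊥

    image : Pred A.Carrier p → Pred Carrier (c ⊔ ℓ′ ⊔ p)
    image F u = ∃[ a ] (a ∈ F × u ≈ e a)

    IsClosed : Pred Carrier (c ⊔ ℓ′ ⊔ suc p)
    IsClosed u = ∃[ F ] (Satisfiable F × u ≈ ⋀ (image F))

    IsOpen : Pred Carrier (c ⊔ ℓ′ ⊔ suc p)
    IsOpen u = ∃[ I ] (Satisfiable I × u ≈ ⋁ (image I))

  -- Finite subsets are given by lists. Their meets and joins are computed in A,
  -- which e preserves and whose order e reflects.
  record IsCanonicalExtension {c′ ℓ′ p : Level} (C : Completion c′ ℓ′ p)
                              : Set (c ⊔ ℓ₂ ⊔ c′ ⊔ suc (c ⊔ ℓ′ ⊔ p)) where
    open Completion C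
    field
      dense-⋁ : ∀ u → ∃[ S ] (S ⊆ IsClosed × u ≈ ⋁ S)
      dense-⋀ : ∀ u → ∃[ S ] (S ⊆ IsOpen × u ≈ ⋀ S)
      compact : ∀ (F I : Pred A.Carrier p) → Satisfiable F → Satisfiable I →
                ⋀ (image F) ≤ ⋁ (image I) →
                ∃₂ λ (F′ I′ : List A.Carrier) → All F F′ × All I I′ ×
                  foldr A._∧_ A.⊤ F′ A.≤ foldr A._∨_ A.⊥ I′

  record CanonicalExtension (c′ ℓ′ p : Level)
                            : Set (suc (c ⊔ ℓ₁ ⊔ ℓ₂ ⊔ c′ ⊔ ℓ′ ⊔ p)) where
    field
      completion           : Completion c′ ℓ′ p
      isCanonicalExtension : IsCanonicalExtension completion

    open Completion completion public
    open IsCanonicalExtension isCanonicalExtension public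

module _ {c ℓ₁ ℓ₂ : Level} (A : BoundedDistributiveLattice c ℓ₁ ℓ₂) where
  open BoundedDistributiveLattice A

  record IsSubordinationAlgebra {p : Level} (_≺_ : Rel Carrier p)
                                : Set (c ⊔ ℓ₂ ⊔ p) where
    field
      ⊥≺⊥    : ⊥ ≺ ⊥
      ⊤≺⊤    : ⊤ ≺ ⊤
      ≺-∧    : ∀ {a b c} → a ≺ b → a ≺ c → a ≺ (b ∧ c)
      ∨-≺    : ∀ {a b c} → a ≺ c → b ≺ c → (a ∨ b) ≺ c
      ≤-≺-≤  : ∀ {a b c d} → a ≤ b → b ≺ c → c ≤ d → a ≺ d

module _ {c ℓ₁ ℓ₂ c′ ℓ′ p : Level} (A : BoundedDistributiveLattice c ℓ₁ ℓ₂)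
         (Aᵟ : CanonicalExtension (BoundedDistributiveLattice.boundedLattice A) c′ ℓ′ p)
         where
  private
    module A = BoundedDistributiveLattice A
    module C = CanonicalExtension Aᵟ
  open C using (e)

  -- ⇒-cong says that _⇒_ is a function on the setoids underlying A and Aᵟ.
  record IsSlantedHeytingAlgebra (_⇒_ : A.Carrier → A.Carrier → C.Carrier)
                                 : Set (c ⊔ ℓ₁ ⊔ ℓ′ ⊔ suc p) where
    field
      ⇒-cong : _⇒_ Preserves₂ A._≈_ ⟶ A._≈_ ⟶ C._≈_
      ⇒-open : ∀ a b → C.IsOpen (a ⇒ b)
      ⇒-∧    : ∀ a b₁ b₂ → (a ⇒ (b₁ A.∧ b₂)) C.≈ ((a ⇒ b₁) C.∧ (a ⇒ b₂))
      ⇒-⊤    : ∀ a → (a ⇒ A.⊤) C.≈ C.⊤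
      ∨-⇒    : ∀ a₁ a₂ b → ((a₁ A.∨ a₂) ⇒ b) C.≈ ((a₁ ⇒ b) C.∧ (a₂ ⇒ b))
      ⊥-⇒    : ∀ b → (A.⊥ ⇒ b) C.≈ C.⊤
      ⇒-adj  : ∀ a b c → (e c C.≤ (a ⇒ b)) ⇔ (e (a A.∧ c) C.≤ (A.⊤ ⇒ b))

  implication : Rel A.Carrier p → A.Carrier → A.Carrier → C.Carrier
  implication _≺_ a b = C.⋁ (C.image λ c → (a A.∧ c) ≺ b)

  subordination : (A.Carrier → A.Carrier → C.Carrier) → Rel A.Carrier p
  subordination _⇒_ a b = e a C.≤ (A.⊤ ⇒ b)

{-# OPTIONS --safe #-}
module Submission where

-- In Aᵟ, a meet of two open elements is a join of closed elements, and by
-- compactness a closed element below an open one is separated from it by an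
-- element of A. Hence inequalities between finite meets of open elements can be
-- tested on A, where the adjunction (i) turns them into properties of ≺.

open import Defs
open import Data.List.Base using (foldr)
open import Data.List.Relation.Unary.All using (All; []; _∷_)
open import Data.Product.Base using (∃-syntax; _×_; _,_; proj₁; proj₂)
open import Function.Base using (_∘_)
open import Function.Bundles using (_⇔_; mk⇔; module Equivalence)
import Function.Properties.Equivalence as ⇔
open import Level using (Level)
open import Relation.Binary.Core using (Rel)
open import Relation.Binary.Lattice.Bundles using (BoundedLattice)
import Relation.Binary.Lattice.Properties.JoinSemilattice as JoinProperties
import Relation.Binary.Lattice.Properties.MeetSemilattice as MeetProperties
open import Relation.Binary.Morphism.Structures using (module IsOrderMonomorphism)
open import Relation.Unary using (Pred; Satisfiable; _∈_)

open Equivalence using (to; from)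

private
  variable
    c ℓ₁ ℓ₂ c′ ℓ′ p : Level

module CanonicalExtensionProperties
  (A : BoundedLattice c ℓ₁ ℓ₂) (Aᵟ : CanonicalExtension A c′ ℓ′ p) where

  private
    module A = BoundedLattice A
  open CanonicalExtension Aᵟ
  open IsOrderMonomorphism e-isOrderMonomorphism public
    using () renaming (mono to e-mono; cancel to e-cancel)

  ⋁-image-upper : ∀ (I : Pred A.Carrier p) {a} → a ∈ I → e a ≤ ⋁ (image I)
  ⋁-image-upper I a∈I = ⋁-upper (image I) (_ , a∈I , Eq.refl)

  ⋁-image-least : ∀ (I : Pred A.Carrier p) {u} → (∀ {a} → a ∈ I → e a ≤ u) → ⋁ (image I) ≤ u
  ⋁-image-least I I≤u = ⋁-least (image I) λ { (_ , a∈I , x≈ea) → ≤-respˡ-≈ (Eq.sym x≈ea) (I≤u a∈I) }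

  ⋀-image-lower : ∀ (F : Pred A.Carrier p) {a} → a ∈ F → ⋀ (image F) ≤ e a
  ⋀-image-lower F a∈F = ⋀-lower (image F) (_ , a∈F , Eq.refl)

  -- Compactness yields finite meets and joins computed in `A`. This lemma and `e-foldr-∨≤` compare
  -- their images with elements of the completion; the empty list is where `e-⊤` and `e-⊥` enter.
  ≤e-foldr-∧ : ∀ {u} {F : Pred A.Carrier p} → (∀ {a} → a ∈ F → u ≤ e a) →
               ∀ {as} → All F as → u ≤ e (foldr A._∧_ A.⊤ as)
  ≤e-foldr-∧ u≤F []            = ≤-respʳ-≈ (Eq.sym e-⊤) (maximum _)
  ≤e-foldr-∧ u≤F (a∈F ∷ as∈F) =
    ≤-respʳ-≈ (Eq.sym (e-∧ _ _)) (∧-greatest (u≤F a∈F) (≤e-foldr-∧ u≤F as∈F))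

  e-foldr-∨≤ : ∀ {u} {I : Pred A.Carrier p} → (∀ {a} → a ∈ I → e a ≤ u) →
               ∀ {as} → All I as → e (foldr A._∨_ A.⊥ as) ≤ u
  e-foldr-∨≤ I≤u []            = ≤-respˡ-≈ (Eq.sym e-⊥) (minimum _)
  e-foldr-∨≤ I≤u (a∈I ∷ as∈I) =
    ≤-respˡ-≈ (Eq.sym (e-∨ _ _)) (∨-least (I≤u a∈I) (e-foldr-∨≤ I≤u as∈I))

  -- The up-set of a is used because {a} need not be a predicate at level p.
  e-closed : ∀ a → IsClosed (e a)
  e-closed a = ↑a , (a , refl) , antisym
    (⋀-greatest (image ↑a) λ { (_ , ea≤eb , x≈eb) → ≤-respʳ-≈ (Eq.sym x≈eb) ea≤eb })
    (⋀-image-lower ↑a refl)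
    where
    ↑a : Pred A.Carrier p
    ↑a b = e a ≤ e b

  -- Compactness gives a finite meet of members of `F` below a finite join of members of `I`; as `k`
  -- is the meet of all of `F`, it lies below that finite meet.
  closed≤⋁⇒finite : ∀ {k} {I : Pred A.Carrier p} → IsClosed k → Satisfiable I → k ≤ ⋁ (image I) →
                    ∃[ as ] (All I as × k ≤ e (foldr A._∨_ A.⊥ as))
  closed≤⋁⇒finite {I = I} (F , F≠∅ , k≈⋀F) I≠∅ k≤⋁I
    with F′ , I′ , F′⊆F , I′⊆I , ⋀F′≤⋁I′ ← compact F I F≠∅ I≠∅ (≤-respˡ-≈ k≈⋀F k≤⋁I)
    = I′ , I′⊆I , ≤-respˡ-≈ (Eq.sym k≈⋀F)
        (trans (≤e-foldr-∧ (⋀-image-lower F) F′⊆F) (e-mono ⋀F′≤⋁I′))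

  -- The interpolant is the finite join supplied by compactness, which stays below the join of all
  -- of `I`.
  closed≤open⇒interpolant : ∀ {k u} → IsClosed k → IsOpen u → k ≤ u → ∃[ a ] (k ≤ e a × e a ≤ u)
  closed≤open⇒interpolant k-closed (I , I≠∅ , u≈⋁I) k≤u
    with as , as⊆I , k≤e⋁as ← closed≤⋁⇒finite k-closed I≠∅ (≤-respʳ-≈ u≈⋁I k≤u)
    = foldr A._∨_ A.⊥ as , k≤e⋁as ,
      ≤-respʳ-≈ (Eq.sym u≈⋁I) (e-foldr-∨≤ (⋁-image-upper I) as⊆I)

  -- The hypotheses say that `I` is an ideal. By compactness `e a` lies below a finite join of
  -- members of `I`; that join is again in `I`, and since `e` reflects the order, so is `a`.
  e≤⋁⇔∈ : ∀ {I : Pred A.Carrier p} → A.⊥ ∈ I → (∀ {a b} → a ∈ I → b ∈ I → a A.∨ b ∈ I) →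
          (∀ {a b} → a A.≤ b → b ∈ I → a ∈ I) → ∀ a → (e a ≤ ⋁ (image I)) ⇔ a ∈ I
  e≤⋁⇔∈ {I = I} ⊥∈I ∨∈I ↓∈I a = mk⇔ ⇒∈ (⋁-image-upper I)
    where
    foldr-∨∈I : ∀ {as} → All I as → foldr A._∨_ A.⊥ as ∈ I
    foldr-∨∈I []           = ⊥∈I
    foldr-∨∈I (b∈I ∷ bs∈I) = ∨∈I b∈I (foldr-∨∈I bs∈I)

    ⇒∈ : e a ≤ ⋁ (image I) → a ∈ I
    ⇒∈ ea≤⋁I with as , as⊆I , ea≤e⋁as ← closed≤⋁⇒finite (e-closed a) (_ , ⊥∈I) ea≤⋁I
      = ↓∈I (e-cancel ea≤e⋁as) (foldr-∨∈I as⊆I)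

  -- An open element is the join of the elements of `A` below it.
  open≤ : ∀ {u v} → IsOpen u → (∀ a → e a ≤ u → e a ≤ v) → u ≤ v
  open≤ (I , _ , u≈⋁I) u≤v = ≤-respˡ-≈ (Eq.sym u≈⋁I)
    (⋁-image-least I λ a∈I → u≤v _ (≤-respʳ-≈ (Eq.sym u≈⋁I) (⋁-image-upper I a∈I)))

  -- `open≤` would require `u ∧ v` to be open. Density instead presents it as a join of closed
  -- elements, each of which is compared with `w` separately.
  open-∧-open≤ : ∀ {u v w} → IsOpen u → IsOpen v →
                 (∀ a → e a ≤ u → e a ≤ v → e a ≤ w) → u ∧ v ≤ w
  open-∧-open≤ {u} {v} {w} u-open v-open uv≤w with S , S⊆closed , u∧v≈⋁S ← dense-⋁ (u ∧ v)
    = ≤-respˡ-≈ (Eq.sym u∧v≈⋁S) (⋁-least S k≤w)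
    where
    k≤w : ∀ {k} → k ∈ S → k ≤ w
    k≤w k∈S
      with k≤u∧v ← ≤-respʳ-≈ (Eq.sym u∧v≈⋁S) (⋁-upper S k∈S)
      with a , k≤ea , ea≤u ← closed≤open⇒interpolant (S⊆closed k∈S) u-open (trans k≤u∧v (x∧y≤x u v))
      with b , k≤eb , eb≤v ← closed≤open⇒interpolant (S⊆closed k∈S) v-open (trans k≤u∧v (x∧y≤y u v))
      -- The interpolants below `u` and below `v` may differ; their meet still lies above `k` and is
      -- below both `u` and `v`.
      = trans (≤-respʳ-≈ (Eq.sym (e-∧ a b)) (∧-greatest k≤ea k≤eb))
          (uv≤w (a A.∧ b) (trans (e-mono (A.x∧y≤x a b)) ea≤u) (trans (e-mono (A.x∧y≤y a b)) eb≤v))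

  open≈open-∧-open : ∀ {u v w} → IsOpen u → IsOpen v → IsOpen w →
                     (∀ a → (e a ≤ u) ⇔ (e a ≤ v × e a ≤ w)) → u ≈ v ∧ w
  open≈open-∧-open u-open v-open w-open u⇔vw = antisym
    (∧-greatest (open≤ u-open λ a → proj₁ ∘ to (u⇔vw a)) (open≤ u-open λ a → proj₂ ∘ to (u⇔vw a)))
    (open-∧-open≤ v-open w-open λ a ea≤v ea≤w → from (u⇔vw a) (ea≤v , ea≤w))

  open≈open : ∀ {u v} → IsOpen u → IsOpen v → (∀ a → (e a ≤ u) ⇔ (e a ≤ v)) → u ≈ v
  open≈open u-open v-open u⇔v = antisym (open≤ u-open (to ∘ u⇔v)) (open≤ v-open (from ∘ u⇔v))

  e⊤≤⇒≈⊤ : ∀ {u} → e A.⊤ ≤ u → u ≈ ⊤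
  e⊤≤⇒≈⊤ e⊤≤u = antisym (maximum _) (≤-respˡ-≈ e-⊤ e⊤≤u)

module _ (A : BoundedDistributiveLattice c ℓ₁ ℓ₂)
         (Aᵟ : CanonicalExtension (BoundedDistributiveLattice.boundedLattice A) c′ ℓ′ p)
         where
  private
    module A = BoundedDistributiveLattice A
    module C = CanonicalExtension Aᵟ
    open C using (e)
    open CanonicalExtensionProperties A.boundedLattice Aᵟ
    open MeetProperties A.meetSemilattice using (∧-monotonic)
    open JoinProperties A.joinSemilattice using (∨-monotonic)

    ∧-monoˡ : ∀ {a b} x → a A.≤ b → a A.∧ x A.≤ b A.∧ x
    ∧-monoˡ _ a≤b = ∧-monotonic a≤b A.refl

    ∧-monoʳ : ∀ {a b} x → a A.≤ b → x A.∧ a A.≤ x A.∧ b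
    ∧-monoʳ _ a≤b = ∧-monotonic A.refl a≤b

    ≤⊤∧ : ∀ a → a A.≤ A.⊤ A.∧ a
    ≤⊤∧ a = A.∧-greatest (A.maximum a) A.refl

    ∨-∧≤ : ∀ a b x → (a A.∨ b) A.∧ x A.≤ (a A.∧ x) A.∨ (b A.∧ x)
    ∨-∧≤ a b x = A.trans (A.∧-greatest (A.x∧y≤y _ _) (A.x∧y≤x _ _))
      (A.trans (A.reflexive (A.∧-distribˡ-∨ x a b))
        (∨-monotonic (A.∧-greatest (A.x∧y≤y _ _) (A.x∧y≤x _ _))
                     (A.∧-greatest (A.x∧y≤y _ _) (A.x∧y≤x _ _))))

  module FromSubordination {_≺_ : Rel A.Carrier p} (isSub : IsSubordinationAlgebra A _≺_) where
    open IsSubordinationAlgebra isSub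

    private
      _⇒_ : A.Carrier → A.Carrier → C.Carrier
      _⇒_ = implication A Aᵟ _≺_

      ≤-≺ : ∀ {a b d} → a A.≤ b → b ≺ d → a ≺ d
      ≤-≺ a≤b b≺d = ≤-≺-≤ a≤b b≺d A.refl

      ≺-≤ : ∀ {a b d} → a ≺ b → b A.≤ d → a ≺ d
      ≺-≤ a≺b b≤d = ≤-≺-≤ A.refl a≺b b≤d

      ≤⊥⇒≺ : ∀ {a b} → a A.≤ A.⊥ → a ≺ b
      ≤⊥⇒≺ a≤⊥ = ≤-≺-≤ a≤⊥ ⊥≺⊥ (A.minimum _)

    -- For fixed `a` and `b`, the elements `c` with `(a ∧ c) ≺ b` form an ideal: closure under joins
    -- combines distributivity with `∨-≺`, and the other two conditions follow from `≤-≺-≤` and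
    -- `⊥≺⊥`.
    implication-adjoint : ∀ a b c → (e c C.≤ (a ⇒ b)) ⇔ ((a A.∧ c) ≺ b)
    implication-adjoint a b = e≤⋁⇔∈
      (≤⊥⇒≺ (A.x∧y≤y _ _))
      (λ ac≺b ad≺b → ≤-≺ (A.reflexive (A.∧-distribˡ-∨ _ _ _)) (∨-≺ ac≺b ad≺b))
      (λ c≤d ad≺b → ≤-≺ (∧-monoʳ a c≤d) ad≺b)

    ⊤∧≺⇔≺ : ∀ a b → ((A.⊤ A.∧ a) ≺ b) ⇔ (a ≺ b)
    ⊤∧≺⇔≺ a b = mk⇔ (≤-≺ (≤⊤∧ a)) (≤-≺ (A.x∧y≤y _ _))

    subordination-implication : ∀ a b → subordination A Aᵟ _⇒_ a b ⇔ (a ≺ b)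
    subordination-implication a b = ⇔.trans (implication-adjoint A.⊤ b a) (⊤∧≺⇔≺ a b)

    implication-open : ∀ a b → C.IsOpen (a ⇒ b)
    implication-open a b = _ , (A.⊥ , ≤⊥⇒≺ (A.x∧y≤y _ _)) , C.Eq.refl

    -- All values are open, so each equation is tested on elements of `A`, where the adjunction
    -- turns it into a closure property of `≺`. The top element is reached as soon as `e ⊤` lies
    -- below the value.
    implication-isSlantedHeytingAlgebra : IsSlantedHeytingAlgebra A Aᵟ _⇒_
    implication-isSlantedHeytingAlgebra = record
      { ⇒-cong = λ a≈a′ b≈b′ → open≈open (implication-open _ _) (implication-open _ _) λ c →
          via (mk⇔
                (≤-≺-≤′ (∧-monoˡ c (A.reflexive (A.Eq.sym a≈a′))) (A.reflexive b≈b′))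
                (≤-≺-≤′ (∧-monoˡ c (A.reflexive a≈a′)) (A.reflexive (A.Eq.sym b≈b′))))
      ; ⇒-open = implication-open
      ; ⇒-∧    = λ a b₁ b₂ →
          open≈open-∧-open (implication-open _ _) (implication-open _ _) (implication-open _ _) λ c →
          via-× (mk⇔
            (λ ac≺b → ≺-≤ ac≺b (A.x∧y≤x b₁ b₂) , ≺-≤ ac≺b (A.x∧y≤y b₁ b₂))
            (λ (ac≺b₁ , ac≺b₂) → ≺-∧ ac≺b₁ ac≺b₂))
      ; ⇒-⊤    = λ a → e⊤≤⇒≈⊤ (from (implication-adjoint _ _ _) (≤-≺ (A.maximum _) ⊤≺⊤))
      ; ∨-⇒    = λ a₁ a₂ b →
          open≈open-∧-open (implication-open _ _) (implication-open _ _) (implication-open _ _) λ c →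
          via-× (mk⇔
            (λ ac≺b → ≤-≺ (∧-monoˡ c (A.x≤x∨y a₁ a₂)) ac≺b , ≤-≺ (∧-monoˡ c (A.y≤x∨y a₁ a₂)) ac≺b)
            -- Distributivity is needed here to split `(a₁ ∨ a₂) ∧ c` before `∨-≺` applies.
            (λ (a₁c≺b , a₂c≺b) → ≤-≺ (∨-∧≤ a₁ a₂ c) (∨-≺ a₁c≺b a₂c≺b)))
      ; ⊥-⇒    = λ b → e⊤≤⇒≈⊤ (from (implication-adjoint _ _ _) (≤⊥⇒≺ (A.x∧y≤x _ _)))
      -- Both sides amount to `(a ∧ c) ≺ b`: the left by the adjunction, the right by recovering `≺`
      -- from the implication with antecedent `⊤`.
      ; ⇒-adj  = λ a b c →
          ⇔.trans (implication-adjoint a b c) (⇔.sym (subordination-implication (a A.∧ c) b))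
      }
      where
      ≤-≺-≤′ : ∀ {a b x y} → a A.≤ b → x A.≤ y → b ≺ x → a ≺ y
      ≤-≺-≤′ a≤b x≤y b≺x = ≤-≺-≤ a≤b b≺x x≤y

      via : ∀ {a b a′ b′ x} → ((a A.∧ x) ≺ b) ⇔ ((a′ A.∧ x) ≺ b′) →
            (e x C.≤ (a ⇒ b)) ⇔ (e x C.≤ (a′ ⇒ b′))
      via eq = ⇔.trans (implication-adjoint _ _ _) (⇔.trans eq (⇔.sym (implication-adjoint _ _ _)))

      via-× : ∀ {a b a′ b′ a″ b″ x} →
              ((a A.∧ x) ≺ b) ⇔ (((a′ A.∧ x) ≺ b′) × ((a″ A.∧ x) ≺ b″)) →
              (e x C.≤ (a ⇒ b)) ⇔ (e x C.≤ (a′ ⇒ b′) × e x C.≤ (a″ ⇒ b″))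
      via-× eq = mk⇔
        (λ ex≤ → let (l , r) = to eq (to (implication-adjoint _ _ _) ex≤)
                 in from (implication-adjoint _ _ _) l , from (implication-adjoint _ _ _) r)
        (λ (l , r) → from (implication-adjoint _ _ _)
          (from eq (to (implication-adjoint _ _ _) l , to (implication-adjoint _ _ _) r)))

  module FromSlantedHeyting {_⇒_ : A.Carrier → A.Carrier → C.Carrier}
                            (isSlanted : IsSlantedHeytingAlgebra A Aᵟ _⇒_) where
    open IsSlantedHeytingAlgebra isSlanted

    -- Preserving binary meets forces monotonicity, because `b ≤ d` means `b ≈ b ∧ d`; `⇒-cong`
    -- carries this equality through the implication.
    ⇒-monoʳ : ∀ a {b d} → b A.≤ d → (a ⇒ b) C.≤ (a ⇒ d)
    ⇒-monoʳ a {b} {d} b≤d = C.trans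
      (C.reflexive (C.Eq.trans (⇒-cong A.Eq.refl b≈b∧d) (⇒-∧ a b d)))
      (C.x∧y≤y _ _)
      where
      b≈b∧d : b A.≈ b A.∧ d
      b≈b∧d = A.antisym (A.∧-greatest A.refl b≤d) (A.x∧y≤x b d)

    -- The axioms on the right of the relation hold because `⊤ ⇒_` preserves finite meets, those on
    -- the left because `e` preserves finite joins.
    subordination-isSubordinationAlgebra : IsSubordinationAlgebra A (subordination A Aᵟ _⇒_)
    subordination-isSubordinationAlgebra = record
      { ⊥≺⊥   = C.≤-respˡ-≈ (C.Eq.sym C.e-⊥) (C.minimum _)
      ; ⊤≺⊤   = C.≤-respʳ-≈ (C.Eq.sym (⇒-⊤ A.⊤)) (C.maximum _)
      ; ≺-∧   = λ a≺b a≺c → C.≤-respʳ-≈ (C.Eq.sym (⇒-∧ _ _ _)) (C.∧-greatest a≺b a≺c)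
      ; ∨-≺   = λ a≺c b≺c → C.≤-respˡ-≈ (C.Eq.sym (C.e-∨ _ _)) (C.∨-least a≺c b≺c)
      ; ≤-≺-≤ = λ a≤b b≺c c≤d → C.trans (e-mono a≤b) (C.trans b≺c (⇒-monoʳ A.⊤ c≤d))
      }

    -- By `⇒-adj` the left side is the join of exactly those elements of `A` that lie below `a ⇒ b`;
    -- this join is `a ⇒ b` itself because that element is open.
    implication-subordination : ∀ a b → implication A Aᵟ (subordination A Aᵟ _⇒_) a b C.≈ (a ⇒ b)
    implication-subordination a b = C.antisym
      (⋁-image-least _ λ {c} → from (⇒-adj a b c))
      (open≤ (⇒-open a b) λ c → ⋁-image-upper _ ∘ to (⇒-adj a b c))

proposition3p3 :
    {c ℓ₁ ℓ₂ c′ ℓ′ p : Level}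
    (A : BoundedDistributiveLattice c ℓ₁ ℓ₂)
    (Aᵟ : CanonicalExtension (BoundedDistributiveLattice.boundedLattice A) c′ ℓ′ p) →
    let module A = BoundedDistributiveLattice A
        module C = CanonicalExtension Aᵟ
    in
    (_≺_ : Rel A.Carrier p) → IsSubordinationAlgebra A _≺_ →
    (_⇒_ : A.Carrier → A.Carrier → C.Carrier) → IsSlantedHeytingAlgebra A Aᵟ _⇒_ →
    let _⇒≺_ = implication A Aᵟ _≺_
        _≺⇒_ = subordination A Aᵟ _⇒_
    in
    (∀ a b c → (C.e c C.≤ (a ⇒≺ b)) ⇔ ((a A.∧ c) ≺ b))
    × IsSlantedHeytingAlgebra A Aᵟ _⇒≺_
    × IsSubordinationAlgebra A _≺⇒_
    × (∀ a b → subordination A Aᵟ _⇒≺_ a b ⇔ (a ≺ b))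
    × (∀ a b → implication A Aᵟ _≺⇒_ a b C.≈ (a ⇒ b))
proposition3p3 A Aᵟ _≺_ isSub _⇒_ isSlanted =
    implication-adjoint
  , implication-isSlantedHeytingAlgebra
  , subordination-isSubordinationAlgebra
  , subordination-implication
  , implication-subordination
  where
  open FromSubordination A Aᵟ isSub
  open FromSlantedHeyting A Aᵟ isSlanted
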